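{- For any $i,j\in\omega$, the family $[S]_i$ is closed-r.e.-generic, where $S$ ($j$-Deduction) is the schema of all universal closures of $\Box_j(\phi\rightarrow\psi)\rightarrow\Box_j\phi\rightarrow\Box_j\psi$, for $\mathcal{L}_{\mathrm{PA}}(\omega)$-formulas $\phi,\psi$.
   Context: Base logic: first-order logic extended by unary operators $\Box$ (formulas $\Box\phi$, $\mathrm{FV}(\Box\phi)=\mathrm{FV}(\phi)$); a structure additionally assigns a truth value $\mathscr{M}\models\Box\phi[s]$ to each operator, formula and assignment, independent of $s(x)$ for $x\notin\mathrm{FV}(\phi)$, invariant under alphabetic variants, and respecting variable substitution; validity, $\models$ as usual; theories are sets of sentences. $\mathcal{L}_{\mathrm{PA}}$ is the language of arithmetic; $\mathcal{L}_{\mathrm{PA}}(\omega)$ adds operators $\Box_i$, $i\in\omega$. $\phi^s$ is $\phi$ with each free variable $x$ replaced by the numeral $\overline{s(x)}$. For a family $\mathbf{U}=(U_i)_{i\in\omega}$ of $\mathcal{L}_{\mathrm{PA}}(\omega)$-theories, $\mathscr{M}_{\mathbf{U}}$ has universe $\mathbb{N}$, standard arithmetic, and $\mathscr{M}_{\mathbf{U}}\models\Box_i\phi[s]$ iff $U_i\models\phi^s$. $\mathbf{U}$ is closed if $\Box_i\phi\in U_i$ whenever $\phi\in U_i$; r.e. if $\{(\phi,i):\phi\in U_i\}$ is r.e.; $\mathbf{T}\subseteq\mathbf{U}$ componentwise. A family $\mathbf{T}$ is closed-r.e.-generic if it is r.e. and $\mathscr{M}_{\mathbf{U}}\models T_k$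 for all $k$ whenever $\mathbf{U}\supseteq\mathbf{T}$ is a closed r.e. family of $\mathcal{L}_{\mathrm{PA}}(\omega)$-theories. $[S]_i$ is the family with $S$ at index $i$ and $\emptyset$ elsewhere. -}

module Defs where

open import Level using (Level; Lift) renaming (suc to lsuc; zero to lzero)
open import Data.Nat using (ℕ; zero; suc; _+_; _*_; _∸_; _⊔_)
open import Data.Product using (Σ; ∃; _×_; _,_)
open import Data.Sum using (_⊎_)
open import Data.Maybe using (Maybe; just)
open import Data.Empty using (⊥)
open import Relation.Nullary using (¬_)
open import Relation.Binary.PropositionalEquality using (_≡_)
open import Function using (_∘_; _⇔_)

-- Variables are natural numbers; `all` binds variable 0.
-- Primitive logical symbols: =, ⊥, →, ∀, and the operators □_i.
-- (¬, ∧, ∨, ∃, ↔ are the usual abbreviations.)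

data Term : Set where
  var  : ℕ → Term
  zer  : Term
  succ : Term → Term
  plus : Term → Term → Term
  mult : Term → Term → Term

data Formula : Set where
  eq  : Term → Term → Formula
  bot : Formula
  imp : Formula → Formula → Formula
  all : Formula → Formula
  box : ℕ → Formula → Formula

FreeT : ℕ → Term → Set
FreeT x (var y)    = x ≡ y
FreeT x zer        = ⊥
FreeT x (succ t)   = FreeT x t
FreeT x (plus t u) = FreeT x t ⊎ FreeT x u
FreeT x (mult t u) = FreeT x t ⊎ FreeT x u

Free : ℕ → Formula → Set
Free x (eq t u)  = FreeT x t ⊎ FreeT x u
Free x bot       = ⊥
Free x (imp φ ψ) = Free x φ ⊎ Free x ψ
Free x (all φ)   = Free (suc x) φ
Free x (box i φ) = Free x φ

Sentence : Formula → Set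
Sentence φ = ∀ x → ¬ Free x φ

renT : (ℕ → ℕ) → Term → Term
renT ρ (var x)    = var (ρ x)
renT ρ zer        = zer
renT ρ (succ t)   = succ (renT ρ t)
renT ρ (plus t u) = plus (renT ρ t) (renT ρ u)
renT ρ (mult t u) = mult (renT ρ t) (renT ρ u)

substT : (ℕ → Term) → Term → Term
substT σ (var x)    = σ x
substT σ zer        = zer
substT σ (succ t)   = succ (substT σ t)
substT σ (plus t u) = plus (substT σ t) (substT σ u)
substT σ (mult t u) = mult (substT σ t) (substT σ u)

exts : (ℕ → Term) → ℕ → Term
exts σ zero    = var zero
exts σ (suc x) = renT suc (σ x)

subst : (ℕ → Term) → Formula → Formula
subst σ (eq t u)  = eq (substT σ t) (substT σ u)
subst σ bot       = bot
subst σ (imp φ ψ) = imp (subst σ φ) (subst σ ψ)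
subst σ (all φ)   = all (subst (exts σ) φ)
subst σ (box i φ) = box i (subst σ φ)

rename : (ℕ → ℕ) → Formula → Formula
rename ρ = subst (var ∘ ρ)

numeral : ℕ → Term
numeral zero    = zer
numeral (suc n) = succ (numeral n)

_^_ : Formula → (ℕ → ℕ) → Formula
φ ^ s = subst (numeral ∘ s) φ

record PreStructure (ℓ : Level) : Set (lsuc ℓ) where
  field
    Carrier : Set
    z       : Carrier
    sc      : Carrier → Carrier
    ad      : Carrier → Carrier → Carrier
    mu      : Carrier → Carrier → Carrier
    boxVal  : ℕ → Formula → (ℕ → Carrier) → Set ℓ

module _ {ℓ : Level} (M : PreStructure ℓ) where
  open PreStructure M

  evalT : (ℕ → Carrier) → Term → Carrier
  evalT s (var x)    = s x
  evalT s zer        = z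
  evalT s (succ t)   = sc (evalT s t)
  evalT s (plus t u) = ad (evalT s t) (evalT s u)
  evalT s (mult t u) = mu (evalT s t) (evalT s u)

  cons : Carrier → (ℕ → Carrier) → ℕ → Carrier
  cons d s zero    = d
  cons d s (suc x) = s x

  Sat : Formula → (ℕ → Carrier) → Set ℓ
  Sat (eq t u)  s = Lift ℓ (evalT s t ≡ evalT s u)
  Sat bot       s = Lift ℓ ⊥
  Sat (imp φ ψ) s = Sat φ s → Sat ψ s
  Sat (all φ)   s = (d : Carrier) → Sat φ (cons d s)
  Sat (box i φ) s = boxVal i φ s

-- A structure: the interpretation of the operators is independent of
-- variables outside FV(φ) and respects variable substitution.
-- (Invariance under alphabetic variants is automatic with de Bruijn syntax.)
record Structure : Set₁ where
  field
    pre : PreStructure lzero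
  open PreStructure pre public
  field
    fv-indep : ∀ i φ (s s′ : ℕ → Carrier) →
               (∀ x → Free x φ → s x ≡ s′ x) →
               boxVal i φ s ⇔ boxVal i φ s′
    respects-subst : ∀ i φ (ρ : ℕ → ℕ) (s : ℕ → Carrier) →
               boxVal i (rename ρ φ) s ⇔ boxVal i φ (s ∘ ρ)

Theory : Set₁
Theory = Formula → Set

_⊨_ : Theory → Formula → Set₁
U ⊨ φ = (M : Structure) (s : ℕ → PreStructure.Carrier (Structure.pre M)) →
        (∀ χ → U χ → Sat (Structure.pre M) χ s) → Sat (Structure.pre M) φ s

Family : Set₁
Family = ℕ → Theory

IsTheoryFamily : Family → Set
IsTheoryFamily U = ∀ i φ → U i φ → Sentence φ

M[_] : Family → PreStructure (lsuc lzero)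
M[ U ] = record
  { Carrier = ℕ ; z = zero ; sc = suc ; ad = _+_ ; mu = _*_
  ; boxVal = λ i φ s → U i ⊨ (φ ^ s) }

Closed : Family → Set
Closed U = ∀ i φ → U i φ → U i (box i φ)

-- r.e.: the set {(φ , i) : φ ∈ U_i} is the range of an enumeration
-- (a proof of this in --safe Agda exhibits a computable enumeration).
IsRE : Family → Set
IsRE U = Σ (ℕ → Maybe (Formula × ℕ)) λ f →
         ∀ φ i → U i φ ⇔ (∃ λ n → f n ≡ just (φ , i))

_⊆F_ : Family → Family → Set
T ⊆F U = ∀ i φ → T i φ → U i φ

ClosedREGeneric : Family → Set₁
ClosedREGeneric T =
  IsRE T ×
  ((U : Family) → IsTheoryFamily U → T ⊆F U → Closed U → IsRE U →
   ∀ k φ → T k φ → (s : ℕ → ℕ) → Sat M[ U ] φ s)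

[_]at_ : Theory → ℕ → Family
([ S ]at i) k φ = (k ≡ i) × S φ

-- 1 + (largest free variable), 0 if none
boundT : Term → ℕ
boundT (var x)    = suc x
boundT zer        = zero
boundT (succ t)   = boundT t
boundT (plus t u) = boundT t ⊔ boundT u
boundT (mult t u) = boundT t ⊔ boundT u

bound : Formula → ℕ
bound (eq t u)  = boundT t ⊔ boundT u
bound bot       = zero
bound (imp φ ψ) = bound φ ⊔ bound ψ
bound (all φ)   = bound φ ∸ 1
bound (box i φ) = bound φ

alls : ℕ → Formula → Formula
alls zero    φ = φ
alls (suc n) φ = all (alls n φ)

ucl : Formula → Formula
ucl φ = alls (bound φ) φ

deductionAx : ℕ → Formula → Formula → Formula
deductionAx j φ ψ = imp (box j (imp φ ψ)) (imp (box j φ) (box j ψ))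

Deduction : ℕ → Theory
Deduction j χ = Σ Formula λ φ → Σ Formula λ ψ → χ ≡ ucl (deductionAx j φ ψ)

{-# OPTIONS --safe #-}
-- The instances of j-Deduction hold in M_U for every family U whatsoever: if U_j ⊨ (φ → ψ)^s
-- and U_j ⊨ φ^s then U_j ⊨ ψ^s, because consequence is closed under modus ponens and
-- (φ → ψ)^s is φ^s → ψ^s. The schema itself is
-- r.e. because Cantor unpairing and a fuel-bounded decoder give a surjection ℕ → Formula.
module Submission where

open import Defs
open import Data.Nat using (ℕ; zero; suc; _+_; _⊔_; _≤_; s≤s)
open import Data.Nat.Properties using (+-suc; +-identityʳ; m≤m⊔n; m≤n⊔m; ≤-refl; ≤-trans)
open import Data.Product using (∃; ∃₂; _×_; _,_; uncurry)
import Data.Product as Product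
open import Data.Maybe using (Maybe; just)
open import Data.Maybe.Properties using (just-injective)
open import Function using (_∘_; id; _⇔_; mk⇔; Equivalence)
open import Function.Definitions using (StrictlySurjective)
open import Relation.Binary.PropositionalEquality
  using (_≡_; refl; sym; trans; cong; cong₂; module ≡-Reasoning) renaming (subst to ≡-subst)

Enumerates : {A : Set} → (ℕ → A) → Set
Enumerates = StrictlySurjective _≡_

next : ℕ × ℕ → ℕ × ℕ
next (a , zero)  = zero , suc a
next (a , suc b) = suc a , b

-- Inverse of Cantor pairing: walk the anti-diagonals of ℕ × ℕ.
unpair : ℕ → ℕ × ℕ
unpair zero    = zero , zero
unpair (suc n) = next (unpair n)

private
  Hit : ℕ × ℕ → Set
  Hit p = ∃ λ n → unpair n ≡ p

  hit-next : ∀ {p} → Hit p → Hit (next p)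
  hit-next (n , e) = suc n , cong next e

  hit-along-diagonal : ∀ a b → Hit (zero , a + b) → Hit (a , b)
  hit-along-diagonal zero    b h = h
  hit-along-diagonal (suc a) b h =
    hit-next (hit-along-diagonal a (suc b) (≡-subst (Hit ∘ (zero ,_)) (sym (+-suc a b)) h))

  hit-diagonal-start : ∀ d → Hit (zero , d)
  hit-diagonal-start zero    = zero , refl
  hit-diagonal-start (suc d) =
    hit-next (hit-along-diagonal d zero
      (≡-subst (Hit ∘ (zero ,_)) (sym (+-identityʳ d)) (hit-diagonal-start d)))

unpair-enumerates : Enumerates unpair
unpair-enumerates (a , b) = hit-along-diagonal a b (hit-diagonal-start (a + b))

pairWith : {A B : Set} → (ℕ → A) → (ℕ → B) → ℕ → A × B
pairWith f g = Product.map f g ∘ unpair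

pairWith-enumerates : {A B : Set} {f : ℕ → A} {g : ℕ → B} →
                      Enumerates f → Enumerates g → Enumerates (pairWith f g)
pairWith-enumerates {f = f} {g} f-enum g-enum (a , b) with f-enum a | g-enum b
... | m , fm≡a | n , gn≡b with unpair-enumerates (m , n)
...   | k , unpair-k≡mn = k , (begin
  pairWith f g k  ≡⟨ cong (Product.map f g) unpair-k≡mn ⟩
  f m , g n       ≡⟨ cong₂ _,_ fm≡a gn≡b ⟩
  a , b           ∎)
  where open ≡-Reasoning

Decoder : Set → Set
Decoder A = ℕ → ℕ → A

Decodes : {A : Set} → Decoder A → A → Set
Decodes dec a = ∃₂ λ fuel n → ∀ {fuel′} → fuel ≤ fuel′ → dec fuel′ n ≡ a

enumerate : {A : Set} → Decoder A → ℕ → A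
enumerate dec = uncurry dec ∘ unpair

enumerate-enumerates : {A : Set} {dec : Decoder A} →
                       (∀ a → Decodes dec a) → Enumerates (enumerate dec)
enumerate-enumerates {dec = dec} complete a with complete a
... | fuel , n , decodes-a with unpair-enumerates (fuel , n)
...   | k , unpair-k≡ = k , trans (cong (uncurry dec) unpair-k≡) (decodes-a ≤-refl)

enumerates⇒decodes : {A : Set} {f : ℕ → A} → Enumerates f → ∀ a → Decodes (λ _ → f) a
enumerates⇒decodes f-enum a with f-enum a
... | n , fn≡a = zero , n , λ _ → fn≡a

decodes-pairWith : {A B : Set} {d : Decoder A} {e : Decoder B} {a : A} {b : B} →
                   Decodes d a → Decodes e b → Decodes (λ fuel → pairWith (d fuel) (e fuel)) (a , b)
decodes-pairWith {d = d} {e} (fuel₁ , m , dm≡a) (fuel₂ , n , en≡b) with unpair-enumerates (m , n)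
... | k , unpair-k≡mn = fuel₁ ⊔ fuel₂ , k , decodes-k
  where
  open ≡-Reasoning
  decodes-k : ∀ {fuel′} → fuel₁ ⊔ fuel₂ ≤ fuel′ → pairWith (d fuel′) (e fuel′) k ≡ _
  decodes-k {fuel′} fuel≤ = begin
    pairWith (d fuel′) (e fuel′) k  ≡⟨ cong (Product.map (d fuel′) (e fuel′)) unpair-k≡mn ⟩
    d fuel′ m , e fuel′ n           ≡⟨ cong₂ _,_ (dm≡a (≤-trans (m≤m⊔n fuel₁ fuel₂) fuel≤))
                                                 (en≡b (≤-trans (m≤n⊔m fuel₁ fuel₂) fuel≤)) ⟩
    _                               ∎

-- Each unit of fuel reads one constructor tag and hands the rest of the code to `node`.
fuelled : {A : Set} → A → ((ℕ → A) → ℕ × ℕ → A) → Decoder A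
fuelled default node zero       n = default
fuelled default node (suc fuel) n = node (fuelled default node fuel) (unpair n)

decodes-node : {A B : Set} {default : A} {node : (ℕ → A) → ℕ × ℕ → A} {b : B}
               (tag : ℕ) (sub : Decoder B) (con : B → A) →
               (∀ fuel r → node (fuelled default node fuel) (tag , r) ≡ con (sub fuel r)) →
               Decodes sub b → Decodes (fuelled default node) (con b)
decodes-node {default = default} {node} {b} tag sub con unfold (fuel , n , sub-n≡b)
  with unpair-enumerates (tag , n)
... | k , unpair-k≡ = suc fuel , k , decodes-k
  where
  open ≡-Reasoning
  decodes-k : ∀ {fuel′} → suc fuel ≤ fuel′ → fuelled default node fuel′ k ≡ con b
  decodes-k {suc fuel′} (s≤s fuel≤) = begin
    node (fuelled default node fuel′) (unpair k)  ≡⟨ cong (node _) unpair-k≡ ⟩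
    node (fuelled default node fuel′) (tag , n)   ≡⟨ unfold fuel′ n ⟩
    con (sub fuel′ n)                             ≡⟨ cong con (sub-n≡b fuel≤) ⟩
    con b                                         ∎

id-enumerates : Enumerates (id {A = ℕ})
id-enumerates n = n , refl

termNode : (ℕ → Term) → ℕ × ℕ → Term
termNode rec (0 , r) = var r
termNode rec (1 , r) = zer
termNode rec (2 , r) = succ (rec r)
termNode rec (3 , r) = uncurry plus (pairWith rec rec r)
termNode rec (_ , r) = uncurry mult (pairWith rec rec r)

decodeTerm : Decoder Term
decodeTerm = fuelled zer termNode

decodeTerm-complete : ∀ t → Decodes decodeTerm t
decodeTerm-complete (var x) =
  decodes-node 0 (λ _ → id) var (λ _ _ → refl) (enumerates⇒decodes id-enumerates x)
decodeTerm-complete zer =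
  decodes-node 1 (λ _ → id) (λ _ → zer) (λ _ _ → refl) (enumerates⇒decodes id-enumerates 0)
decodeTerm-complete (succ t) =
  decodes-node 2 decodeTerm succ (λ _ _ → refl) (decodeTerm-complete t)
decodeTerm-complete (plus t u) =
  decodes-node 3 (λ fuel → pairWith (decodeTerm fuel) (decodeTerm fuel)) (uncurry plus) (λ _ _ → refl)
    (decodes-pairWith (decodeTerm-complete t) (decodeTerm-complete u))
decodeTerm-complete (mult t u) =
  decodes-node 4 (λ fuel → pairWith (decodeTerm fuel) (decodeTerm fuel)) (uncurry mult) (λ _ _ → refl)
    (decodes-pairWith (decodeTerm-complete t) (decodeTerm-complete u))

nthTerm : ℕ → Term
nthTerm = enumerate decodeTerm

nthTerm-enumerates : Enumerates nthTerm
nthTerm-enumerates = enumerate-enumerates decodeTerm-complete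

formulaNode : (ℕ → Formula) → ℕ × ℕ → Formula
formulaNode rec (0 , r) = uncurry eq (pairWith nthTerm nthTerm r)
formulaNode rec (1 , r) = bot
formulaNode rec (2 , r) = uncurry imp (pairWith rec rec r)
formulaNode rec (3 , r) = all (rec r)
formulaNode rec (_ , r) = uncurry box (pairWith id rec r)

decodeFormula : Decoder Formula
decodeFormula = fuelled bot formulaNode

decodeFormula-complete : ∀ φ → Decodes decodeFormula φ
decodeFormula-complete (eq t u) =
  decodes-node 0 (λ _ → pairWith nthTerm nthTerm) (uncurry eq) (λ _ _ → refl)
    (enumerates⇒decodes (pairWith-enumerates nthTerm-enumerates nthTerm-enumerates) (t , u))
decodeFormula-complete bot =
  decodes-node 1 (λ _ → id) (λ _ → bot) (λ _ _ → refl) (enumerates⇒decodes id-enumerates 0)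
decodeFormula-complete (imp φ ψ) =
  decodes-node 2 (λ fuel → pairWith (decodeFormula fuel) (decodeFormula fuel)) (uncurry imp)
    (λ _ _ → refl) (decodes-pairWith (decodeFormula-complete φ) (decodeFormula-complete ψ))
decodeFormula-complete (all φ) =
  decodes-node 3 decodeFormula all (λ _ _ → refl) (decodeFormula-complete φ)
decodeFormula-complete (box i φ) =
  decodes-node 4 (λ fuel → pairWith id (decodeFormula fuel)) (uncurry box) (λ _ _ → refl)
    (decodes-pairWith (enumerates⇒decodes id-enumerates i) (decodeFormula-complete φ))

nthFormula : ℕ → Formula
nthFormula = enumerate decodeFormula

nthFormula-enumerates : Enumerates nthFormula
nthFormula-enumerates = enumerate-enumerates decodeFormula-complete

[]at-isRE : {S : Theory} {i : ℕ} (g : ℕ → Formula) →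
            (∀ χ → S χ ⇔ (∃ λ n → g n ≡ χ)) → IsRE ([ S ]at i)
[]at-isRE {S} {i} g S-range = enum , λ χ k → mk⇔ (listed χ k) (unlisted χ k)
  where
  enum : ℕ → Maybe (Formula × ℕ)
  enum n = just (g n , i)

  listed : ∀ χ k → ([ S ]at i) k χ → ∃ λ n → enum n ≡ just (χ , k)
  listed χ k (refl , Sχ) with Equivalence.to (S-range χ) Sχ
  ... | n , gn≡χ = n , cong (λ ξ → just (ξ , k)) gn≡χ

  unlisted : ∀ χ k → (∃ λ n → enum n ≡ just (χ , k)) → ([ S ]at i) k χ
  unlisted χ k (n , enum-n≡) with just-injective enum-n≡
  ... | refl = refl , Equivalence.from (S-range (g n)) (n , refl)

deductionInstance : ℕ → ℕ → Formula
deductionInstance j = ucl ∘ uncurry (deductionAx j) ∘ pairWith nthFormula nthFormula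

Deduction-range : ∀ j χ → Deduction j χ ⇔ (∃ λ n → deductionInstance j n ≡ χ)
Deduction-range j χ = mk⇔ instance-of axiom-of
  where
  instance-of : Deduction j χ → ∃ λ n → deductionInstance j n ≡ χ
  instance-of (φ , ψ , refl)
    with pairWith-enumerates nthFormula-enumerates nthFormula-enumerates (φ , ψ)
  ... | n , formulas-n≡ = n , cong (ucl ∘ uncurry (deductionAx j)) formulas-n≡

  axiom-of : (∃ λ n → deductionInstance j n ≡ χ) → Deduction j χ
  axiom-of (n , refl) = _ , _ , refl

Sat-alls : ∀ {ℓ} (M : PreStructure ℓ) n {χ} → (∀ s → Sat M χ s) → ∀ s → Sat M (alls n χ) s
Sat-alls M zero    valid s   = valid s
Sat-alls M (suc n) valid s d = Sat-alls M n valid _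

Sat-ucl : ∀ {ℓ} (M : PreStructure ℓ) {χ} → (∀ s → Sat M χ s) → ∀ s → Sat M (ucl χ) s
Sat-ucl M {χ} = Sat-alls M (bound χ)

⊨-mp : ∀ {U φ ψ} → U ⊨ imp φ ψ → U ⊨ φ → U ⊨ ψ
⊨-mp U⊨φ⇒ψ U⊨φ M s M⊨U = U⊨φ⇒ψ M s M⊨U (U⊨φ M s M⊨U)

Sat-deductionAx : ∀ U j φ ψ s → Sat M[ U ] (deductionAx j φ ψ) s
Sat-deductionAx U j φ ψ s = ⊨-mp {U j} {φ ^ s} {ψ ^ s}

lemma3p4 : (i j : ℕ) → ClosedREGeneric ([ Deduction j ]at i)
lemma3p4 i j = []at-isRE (deductionInstance j) (Deduction-range j) , validated
  where
  validated : (U : Family) → IsTheoryFamily U → ([ Deduction j ]at i) ⊆F U → Closed U → IsRE U →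
              ∀ k χ → ([ Deduction j ]at i) k χ → (s : ℕ → ℕ) → Sat M[ U ] χ s
  validated U _ _ _ _ _ _ (_ , φ , ψ , refl) =
    Sat-ucl M[ U ] {deductionAx j φ ψ} (Sat-deductionAx U j φ ψ)
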